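{- Any (probabilistic bounded error or deterministic) symbolic algorithm that computes the strongly connected components (SCCs) of directed graphs with $n$ vertices needs $\Omega(n)$ symbolic one-step operations. Moreover, writing $SCCs(G)$ for the set of SCCs of the input graph $G$ and $D$ for its diameter, any such algorithm needs $\Omega(|SCCs(G)|\cdot D)$ symbolic one-step operations.
   Context: Symbolic model: the input is a finite directed graph $G=(V,E)$ (self-loops allowed), $n=|V|$. The algorithm knows $V$, but it can access $E$ only through the one-step operations $\mathrm{Pre}(S)=\{v\in V\mid \exists s\in S:(v,s)\in E\}$ and $\mathrm{Post}(S)=\{v\in V\mid \exists s\in S:(s,v)\in E\}$ applied to (adaptively chosen) sets $S\subseteq V$. All other computation, in particular basic set operations such as $\cup,\cap,\setminus,\subseteq,=$ on vertex sets, is unrestricted and not counted in lower bounds; any number of sets may be stored. A probabilistic bounded error algorithm may use random bits and must be correct with probability at least $2/3$ on every input. Convention for lower bounds: "needs $\Omega(g)$ one-step operations", for a parameter $g$ of the input, means: there is an absolute constant $c>0$ such that every (deterministic or probabilistic bounded error) symbolic algorithm solving the problem on all inputs performs, on inputs with arbitrarily large $g$, at least $c\cdot g$ one-step operations (worst case over its random choices). The diameter $D$ of $G$ is the largest finite distance: the maximum of $d(u,v)$ over all pairs $u,v$ such that $u$ can reach $v$, where $d(u,v)$ is the smallest number of edges on a path from $u$ to $v$. A single vertex not on any cycle through other vertices forms a (trivial) SCC. -}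

module Defs where

open import Data.Bool.Base using (Bool)
open import Data.Fin.Base using (Fin)
open import Data.Fin.Properties using (any?)
open import Data.Fin.Subset using (Subset; _∈_; _⊆_; Nonempty)
open import Data.Fin.Subset.Properties using (_∈?_)
open import Data.Integer.Base using (+_)
open import Data.List.Base using (List; []; _∷_; length)
open import Data.List.Membership.Propositional using () renaming (_∈_ to _∈ˡ_)
open import Data.List.Relation.Unary.All using (All)
open import Data.List.Relation.Unary.Unique.Propositional using (Unique)
open import Data.Nat.Base using (ℕ; suc; _≤_; _*_; _^_)
open import Data.Nat.Properties using (m^n≢0)
open import Data.Product.Base using (∃-syntax; Σ-syntax; _×_)
open import Data.Rational.Base as ℚ using (ℚ; 0ℚ)
open import Data.Sum.Base using (_⊎_)
open import Data.Vec.Base using (Vec; []; _∷_; tabulate)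
open import Function.Bundles using (_⇔_)
open import Level using (0ℓ)
open import Relation.Binary.Construct.Closure.ReflexiveTransitive using (Star; fold)
open import Relation.Binary.Core using (Rel)
open import Relation.Binary.Definitions using (Decidable)
open import Relation.Binary.PropositionalEquality.Core using (_≡_; _≢_)
open import Relation.Nullary.Decidable using (does; _×-dec_)

record Graph (n : ℕ) : Set₁ where
  field
    _⟶_  : Rel (Fin n) 0ℓ
    _⟶?_ : Decidable _⟶_

module _ {n : ℕ} (G : Graph n) where
  open Graph G

  Walk : Rel (Fin n) 0ℓ
  Walk = Star _⟶_

  edges : ∀ {u v} → Walk u v → ℕ
  edges = fold (λ _ _ → ℕ) (λ _ → suc) 0

  StronglyConnected : Subset n → Set
  StronglyConnected C = ∀ {u v} → u ∈ C → v ∈ C → Walk u v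

  IsSCC : Subset n → Set
  IsSCC C = Nonempty C × StronglyConnected C
          × (∀ C′ → C ⊆ C′ → StronglyConnected C′ → C′ ⊆ C)

  -- The list represents the set of all SCCs; order and repetitions are
  -- irrelevant here.
  IsSetOfSCCs : List (Subset n) → Set
  IsSetOfSCCs Cs = ∀ C → C ∈ˡ Cs ⇔ IsSCC C

  NumberOfSCCs : ℕ → Set
  NumberOfSCCs k = ∃[ Cs ] Unique Cs × IsSetOfSCCs Cs × length Cs ≡ k

  IsDistance : Fin n → Fin n → ℕ → Set
  IsDistance u v d = (Σ[ w ∈ Walk u v ] edges w ≡ d)
                   × (∀ (w : Walk u v) → d ≤ edges w)

  -- The largest finite distance.  (The graph without vertices has none.)
  IsDiameter : ℕ → Set
  IsDiameter D = (∃[ u ] ∃[ v ] IsDistance u v D)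
               × (∀ {u v d} → IsDistance u v d → d ≤ D)

  Pre : Subset n → Subset n
  Pre S = tabulate λ v → does (any? λ s → (s ∈? S) ×-dec (v ⟶? s))

  Post : Subset n → Subset n
  Post S = tabulate λ v → does (any? λ s → (s ∈? S) ×-dec (s ⟶? v))

-- A symbolic algorithm is an arbitrary function that chooses the next move
-- from everything learnt so far (most recent answer first).  Storage and all
-- computation other than Pre and Post are thereby free and unrestricted, and
-- the edges are accessible only through the answers.

data Answer (n : ℕ) : Set where
  vertices : Subset n → Answer n
  coin     : Bool → Answer n

History : ℕ → Set
History n = List (Answer n)

data Move (n : ℕ) : Set where
  pre post : Subset n → Move n
  flip     : Move n
  output   : List (Subset n) → Move n

Strategy : ℕ → Set
Strategy n = History n → Move n

Algorithm : Set
Algorithm = ∀ n → Strategy n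

Deterministic : Algorithm → Set
Deterministic A = ∀ n (h : History n) → A n h ≢ flip

-- Every step is supplied with one random bit, which is discarded unless the
-- move is a coin flip; so runs of k steps are driven by the uniform
-- distribution on Vec Bool k.  After an output the run stays put.

module _ {n : ℕ} (A : Strategy n) (G : Graph n) where

  step : Bool → History n → History n
  step b h with A h
  ... | pre S    = vertices (Pre G S) ∷ h
  ... | post S   = vertices (Post G S) ∷ h
  ... | flip     = coin b ∷ h
  ... | output _ = h

  runFrom : ∀ {k} → History n → Vec Bool k → History n
  runFrom h []      = h
  runFrom h (b ∷ ω) = runFrom (step b h) ω

  run : ∀ {k} → Vec Bool k → History n
  run = runFrom []

  OutputsSCCs : ∀ {k} → Vec Bool k → Set
  OutputsSCCs ω = ∃[ Cs ] A (run ω) ≡ output Cs × IsSetOfSCCs G Cs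

oneStepOps : ∀ {n} → History n → ℕ
oneStepOps []               = 0
oneStepOps (vertices _ ∷ h) = suc (oneStepOps h)
oneStepOps (coin _     ∷ h) = oneStepOps h

-- At least a fraction p of the 2 ^ k outcomes satisfies P, witnessed by a
-- list of distinct outcomes since P need not come with a decision procedure.
ProbabilityAtLeast : ℚ → ∀ {k} → (Vec Bool k → Set) → Set
ProbabilityAtLeast p {k} P =
  ∃[ ωs ] Unique ωs × All P ωs
        × p ℚ.≤ ℚ._/_ (+ length ωs) (2 ^ k) {{m^n≢0 2 k}}

-- Termination is not required on every sequence of coin flips.  The
-- probability of a correct output is the supremum over k of the probability
-- of having produced one within k steps, and "the supremum is at least 2/3"
-- is spelled out with ε.
BoundedErrorSolvesSCC : Algorithm → Set₁
BoundedErrorSolvesSCC A =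
  ∀ {n} (G : Graph n) (ε : ℚ) → 0ℚ ℚ.< ε →
  ∃[ k ] ProbabilityAtLeast (+ 2 ℚ./ 3 ℚ.- ε) (OutputsSCCs (A n) G {k})

DeterministicallySolvesSCC : Algorithm → Set₁
DeterministicallySolvesSCC A =
  Deterministic A ×
  (∀ {n} (G : Graph n) → ∃[ k ] (∀ (ω : Vec Bool k) → OutputsSCCs (A n) G ω))

SolvesSCC : Algorithm → Set₁
SolvesSCC A = DeterministicallySolvesSCC A ⊎ BoundedErrorSolvesSCC A

-- Worst case over the coin flips.
Performs≥ : ∀ {n} → Strategy n → Graph n → ℚ → Set
Performs≥ A G x = ∃[ k ] Σ[ ω ∈ Vec Bool k ] x ℚ.≤ + oneStepOps (run A G ω) ℚ./ 1

-- An input parameter is given by its graph: P G g says that g is the value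
-- of the parameter at G.
Parameter : Set₁
Parameter = ∀ {n} → Graph n → ℕ → Set

SCCNeedsΩ : Parameter → Set₁
SCCNeedsΩ P =
  Σ[ c ∈ ℚ ] 0ℚ ℚ.< c ×
  (∀ (A : Algorithm) → SolvesSCC A →
   ∀ (N : ℕ) → ∃[ n ] Σ[ G ∈ Graph n ] ∃[ g ]
     P G g × N ≤ g × Performs≥ (A n) G (c ℚ.* (+ g ℚ./ 1)))

numberOfVertices : Parameter
numberOfVertices {n} _ g = g ≡ n

numberOfSCCs×diameter : Parameter
numberOfSCCs×diameter G g =
  ∃[ s ] ∃[ D ] NumberOfSCCs G s × IsDiameter G D × g ≡ s * D

{-# OPTIONS --safe #-}

-- On the vertices 0, …, m take all edges u ⟶ v with u ≤ v, together with the
-- backward edges v + 1 ⟶ v.  This "ladder" is a single SCC of diameter m, but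
-- removing the backward edge into one vertex c < m splits it.  Post S contains
-- everything from min S on, and of the vertices below it at most min S - 1, so
-- it tests at most one backward edge; likewise for Pre S and max S.  Hence, on
-- fixed coin flips ω, an algorithm that performs q operations on the ladder
-- behaves alike on all but q of the m broken ladders, and if it is right on the
-- ladder then it is right on at most q broken ones.  With the number of correct
-- broken ladders denoted by b, always b + m [right on the ladder] ≤ m + q.
-- Averaging over ω, where every graph is solved with probability at least 7/12,
-- gives an ω with q ≥ m / 6.
module Submission where

open import Defs
open import Algebra.Properties.CommutativeSemigroup using (interchange)
open import Data.Bool.Base using (Bool; true; false; if_then_else_; _∨_)
open import Data.Bool.Properties using () renaming (_≟_ to _≟ᵇ_)
open import Data.Fin.Base using (Fin; zero; suc; toℕ; fromℕ; fromℕ<; inject₁)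
open import Data.Fin.Properties
  using (any?; toℕ-injective; toℕ<n; toℕ≤pred[n]; toℕ-fromℕ; toℕ-fromℕ<; toℕ-inject₁)
open import Data.Fin.Subset
  using (Subset; _∈_; _∉_; ∣_∣; ⊥; ⊤; ⁅_⁆; _∪_; inside; outside)
open import Data.Fin.Subset.Properties
  using ( _∈?_; ∣⊥∣≡0; ∣⁅x⁆∣≡1; x∈⁅x⁆; x∈p∪q⁺; p⊆q⇒∣p∣≤∣q∣; ∣p∣≤n
        ; ∈⊤; ⊆⊤; ⊆-antisym)
open import Data.Integer.Base as ℤ using (+_; +≤+; +<+)
open import Data.Integer.Properties using (drop‿+≤+; pos-*)
open import Data.List.Base using ([]; _∷_; length)
import Data.List.Membership.DecPropositional as DecMembership
open import Data.List.Relation.Unary.All as All using (All; []; _∷_)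
open import Data.List.Relation.Unary.All.Properties using (All¬⇒¬Any)
open import Data.List.Relation.Unary.AllPairs.Core using ([]; _∷_)
open import Data.List.Relation.Unary.Any using (here)
open import Data.List.Relation.Unary.Unique.Propositional using (Unique)
open import Data.Nat.Base
open import Data.Nat.Properties
open import Data.Nat.Tactic.RingSolver using (solve-∀)
open import Data.Product.Base using (_×_; _,_; proj₁; proj₂; ∃-syntax; Σ-syntax)
open import Data.Rational.Base as ℚ using (0ℚ)
import Data.Rational.Properties as ℚ
open import Data.Rational.Unnormalised.Base as ℚᵘ using (mkℚᵘ; *≤*)
import Data.Rational.Unnormalised.Properties as ℚᵘ
open import Data.Sum.Base using (_⊎_; inj₁; inj₂)
open import Data.Vec.Base using (Vec; []; _∷_; take; tabulate)
open import Data.Vec.Properties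
  using (≡-dec; []=⇒lookup; lookup∘tabulate; tabulate-cong)
open import Function.Base using (_∘_)
open import Function.Bundles using (_⇔_; mk⇔; module Equivalence)
open import Level using (0ℓ)
open import Relation.Binary.Construct.Closure.ReflexiveTransitive using (ε; _◅_)
open import Relation.Binary.PropositionalEquality
  using (_≡_; _≢_; refl; sym; trans; cong; cong₂; subst; subst₂)
open import Relation.Nullary.Decidable
  using (yes; no; does; does-⇔; dec-true; dec-false; ¬?; _×-dec_; _⊎-dec_)
open import Relation.Nullary.Negation using (¬_; contradiction)
open import Relation.Unary using (Pred; Decidable)

private
  variable
    k m n : ℕ

-- Sums over coin flips

-- This is the expectation scaled by `2 ^ k`, which keeps the averaging argument in `ℕ`.
∑ : (Vec Bool k → ℕ) → ℕ
∑ {zero}  f = f []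
∑ {suc k} f = ∑ (f ∘ (true ∷_)) + ∑ (f ∘ (false ∷_))

∑-cong : {f g : Vec Bool k → ℕ} → (∀ ω → f ω ≡ g ω) → ∑ f ≡ ∑ g
∑-cong {zero}  f≗g = f≗g []
∑-cong {suc k} f≗g = cong₂ _+_ (∑-cong (f≗g ∘ (true ∷_))) (∑-cong (f≗g ∘ (false ∷_)))

∑-mono-≤ : {f g : Vec Bool k → ℕ} → (∀ ω → f ω ≤ g ω) → ∑ f ≤ ∑ g
∑-mono-≤ {zero}  f≤g = f≤g []
∑-mono-≤ {suc k} f≤g = +-mono-≤ (∑-mono-≤ (f≤g ∘ (true ∷_))) (∑-mono-≤ (f≤g ∘ (false ∷_)))

∑-mono-< : {f g : Vec Bool k → ℕ} → (∀ ω → f ω ≤ g ω) → ∀ ω → f ω < g ω → ∑ f < ∑ g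
∑-mono-< f≤g []          f<g = f<g
∑-mono-< f≤g (true  ∷ ω) f<g =
  +-mono-<-≤ (∑-mono-< (f≤g ∘ (true ∷_)) ω f<g) (∑-mono-≤ (f≤g ∘ (false ∷_)))
∑-mono-< f≤g (false ∷ ω) f<g =
  +-mono-≤-< (∑-mono-≤ (f≤g ∘ (true ∷_))) (∑-mono-< (f≤g ∘ (false ∷_)) ω f<g)

∑-distrib-+ : (f g : Vec Bool k → ℕ) → ∑ (λ ω → f ω + g ω) ≡ ∑ f + ∑ g
∑-distrib-+ {zero}  f g = refl
∑-distrib-+ {suc k} f g = trans
  (cong₂ _+_ (∑-distrib-+ (f ∘ (true ∷_)) (g ∘ (true ∷_)))
             (∑-distrib-+ (f ∘ (false ∷_)) (g ∘ (false ∷_))))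
  (interchange +-commutativeSemigroup
    (∑ (f ∘ (true ∷_))) (∑ (g ∘ (true ∷_))) (∑ (f ∘ (false ∷_))) (∑ (g ∘ (false ∷_))))

*-distribˡ-∑ : ∀ x (f : Vec Bool k → ℕ) → ∑ (λ ω → x * f ω) ≡ x * ∑ f
*-distribˡ-∑ {zero}  x f = refl
*-distribˡ-∑ {suc k} x f = trans
  (cong₂ _+_ (*-distribˡ-∑ x (f ∘ (true ∷_))) (*-distribˡ-∑ x (f ∘ (false ∷_))))
  (sym (*-distribˡ-+ x (∑ (f ∘ (true ∷_))) (∑ (f ∘ (false ∷_)))))

double-* : ∀ t x → t * x + t * x ≡ 2 * t * x
double-* = solve-∀

∑-const : ∀ k x → ∑ {k} (λ _ → x) ≡ 2 ^ k * x
∑-const zero    x = sym (*-identityˡ x)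
∑-const (suc k) x = trans (cong₂ _+_ (∑-const k x) (∑-const k x)) (double-* (2 ^ k) x)

-- Each prefix of `k` flips has `2 ^ d` continuations.
∑-take : ∀ k d (f : Vec Bool k → ℕ) → ∑ (f ∘ take k {d}) ≡ 2 ^ d * ∑ f
∑-take zero    d f = ∑-const d (f [])
∑-take (suc k) d f = trans
  (cong₂ _+_ (∑-take k d (f ∘ (true ∷_))) (∑-take k d (f ∘ (false ∷_))))
  (sym (*-distribˡ-+ (2 ^ d) (∑ (f ∘ (true ∷_))) (∑ (f ∘ (false ∷_)))))

-- The mean over all flips is the mean of the two halves, so one can descend into a half whose mean
-- is still at least `x`.
∑-average : ∀ x (f : Vec Bool k → ℕ) → 2 ^ k * x ≤ ∑ f → ∃[ ω ] x ≤ f ω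
∑-average {zero}  x f x≤f = [] , subst (_≤ f []) (*-identityˡ x) x≤f
∑-average {suc k} x f x≤f with 2 ^ k * x ≤? ∑ (f ∘ (true ∷_))
... | yes le = let ω , le′ = ∑-average x (f ∘ (true ∷_)) le in true ∷ ω , le′
... | no  gt with 2 ^ k * x ≤? ∑ (f ∘ (false ∷_))
...   | yes le  = let ω , le′ = ∑-average x (f ∘ (false ∷_)) le in false ∷ ω , le′
...   | no  gt′ = contradiction x≤f (<⇒≱ (subst (∑ f <_) (double-* (2 ^ k) x)
                    (+-mono-< (≰⇒> gt) (≰⇒> gt′))))

-- Finite subsets

χ : Bool → ℕ
χ b = if b then 1 else 0

∣∷∣ : ∀ b (p : Subset n) → ∣ b ∷ p ∣ ≡ χ b + ∣ p ∣
∣∷∣ true  p = refl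
∣∷∣ false p = refl

∣p∪q∣≤∣p∣+∣q∣ : (p q : Subset n) → ∣ p ∪ q ∣ ≤ ∣ p ∣ + ∣ q ∣
∣p∪q∣≤∣p∣+∣q∣ []            []            = z≤n
∣p∪q∣≤∣p∣+∣q∣ (outside ∷ p) (outside ∷ q) = ∣p∪q∣≤∣p∣+∣q∣ p q
∣p∪q∣≤∣p∣+∣q∣ (inside  ∷ p) (outside ∷ q) = s≤s (∣p∪q∣≤∣p∣+∣q∣ p q)
∣p∪q∣≤∣p∣+∣q∣ (outside ∷ p) (inside  ∷ q) =
  ≤-trans (s≤s (∣p∪q∣≤∣p∣+∣q∣ p q)) (≤-reflexive (sym (+-suc ∣ p ∣ ∣ q ∣)))
∣p∪q∣≤∣p∣+∣q∣ (inside  ∷ p) (inside  ∷ q) =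
  s≤s (≤-trans (∣p∪q∣≤∣p∣+∣q∣ p q) (+-monoʳ-≤ ∣ p ∣ (n≤1+n ∣ q ∣)))

subsingleton-support : {P : Pred (Fin m) 0ℓ} → Decidable P →
                       (∀ {i j} → P i → P j → i ≡ j) →
                       ∃[ D ] ∣ D ∣ ≤ 1 × (∀ {j} → j ∉ D → ¬ P j)
subsingleton-support {m} {P} P? unique with any? P?
... | yes (i , pi) = ⁅ i ⁆ , ≤-reflexive (∣⁅x⁆∣≡1 i) ,
                     λ j∉ pj → j∉ (subst (_∈ ⁅ i ⁆) (unique pi pj) (x∈⁅x⁆ i))
... | no  ¬∃       = ⊥ , subst (_≤ 1) (sym (∣⊥∣≡0 m)) z≤n , λ _ pj → ¬∃ (_ , pj)

-- Linearity of expectation: the expected number of `j` with `f j ω` true is the sum of the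
-- individual probabilities.
∑-∣tabulate∣-≥ : ∀ a x (f : Fin m → Vec Bool k → Bool) → (∀ j → x ≤ a * ∑ (χ ∘ f j)) →
                 m * x ≤ a * ∑ (λ ω → ∣ tabulate (λ j → f j ω) ∣)
∑-∣tabulate∣-≥ {zero}      a x f x≤ = z≤n
∑-∣tabulate∣-≥ {suc m} {k} a x f x≤ = begin
  x + m * x                                          ≤⟨ +-mono-≤ (x≤ zero) (∑-∣tabulate∣-≥ a x (f ∘ suc) (x≤ ∘ suc)) ⟩
  a * ∑ (χ ∘ f zero) + a * ∑ tail                    ≡⟨ *-distribˡ-+ a (∑ (χ ∘ f zero)) (∑ tail) ⟨
  a * (∑ (χ ∘ f zero) + ∑ tail)                      ≡⟨ cong (a *_) (∑-distrib-+ (χ ∘ f zero) tail) ⟨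
  a * ∑ (λ ω → χ (f zero ω) + tail ω)                ≡⟨ cong (a *_) (∑-cong (λ ω → ∣∷∣ (f zero ω) (tabulate (λ j → f (suc j) ω)))) ⟨
  a * ∑ (λ ω → ∣ tabulate (λ j → f j ω) ∣)           ∎
  where
  open ≤-Reasoning
  tail : Vec Bool k → ℕ
  tail ω = ∣ tabulate (λ j → f (suc j) ω) ∣

-- Ladders

Edge : ℕ → Fin n → Fin n → Set
Edge c u v = toℕ u ≤ toℕ v ⊎ (toℕ u ≡ suc (toℕ v) × toℕ v ≢ c)

-- The backward edge into c is missing; ladder m m is the intact ladder.
ladder : ∀ m → ℕ → Graph (suc m)
ladder m c = record
  { _⟶_  = Edge c
  ; _⟶?_ = λ u v → (toℕ u ≤? toℕ v) ⊎-dec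
                   ((toℕ u ≟ suc (toℕ v)) ×-dec ¬? (toℕ v ≟ c))
  }

-- The target of a backward edge lies below its source and hence below `m`, so the intact ladder
-- excludes no backward edge.
Edge-intact : ∀ {c} {u v : Fin (suc m)} → Edge c u v → Edge m u v
Edge-intact         (inj₁ u≤v)         = inj₁ u≤v
Edge-intact {u = u} (inj₂ (u≡1+v , _)) =
  inj₂ (u≡1+v , <⇒≢ (s≤s⁻¹ (subst (_< suc _) u≡1+v (toℕ<n u))))

-- One-step operations on ladders

module _ {G H : Graph n} (S : Subset n) where
  private
    module G = Graph G
    module H = Graph H

  Post-cong : (∀ v → (∃[ s ] (s ∈ S × s G.⟶ v)) ⇔ (∃[ s ] (s ∈ S × s H.⟶ v))) →
              Post G S ≡ Post H S
  Post-cong G⇔H = tabulate-cong λ v → does-⇔ (G⇔H v)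
    (any? λ s → (s ∈? S) ×-dec (s G.⟶? v)) (any? λ s → (s ∈? S) ×-dec (s H.⟶? v))

  Pre-cong : (∀ v → (∃[ s ] (s ∈ S × v G.⟶ s)) ⇔ (∃[ s ] (s ∈ S × v H.⟶ s))) →
             Pre G S ≡ Pre H S
  Pre-cong G⇔H = tabulate-cong λ v → does-⇔ (G⇔H v)
    (any? λ s → (s ∈? S) ×-dec (v G.⟶? s)) (any? λ s → (s ∈? S) ×-dec (v H.⟶? s))

-- In other words, `j` + 1 is the minimum of `S`. Exactly then `j` belongs to the `Post` of the
-- intact ladder only through the edge from `j` + 1.
PostTests : Subset (suc m) → Fin m → Set
PostTests S j = suc j ∈ S × ¬ (∃[ t ] (t ∈ S × toℕ t ≤ toℕ j))

PostTests-unique : ∀ {S : Subset (suc m)} {i j} → PostTests S i → PostTests S j → i ≡ j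
PostTests-unique (i∈S , i-min) (j∈S , j-min) = toℕ-injective
  (≤-antisym (≮⇒≥ λ j<i → i-min (_ , j∈S , j<i)) (≮⇒≥ λ i<j → j-min (_ , i∈S , i<j)))

Post-untested : (S : Subset (suc m)) (j : Fin m) → ¬ PostTests S j →
                Post (ladder m (toℕ j)) S ≡ Post (ladder m m) S
Post-untested {m} S j untested =
  Post-cong {G = ladder m (toℕ j)} {ladder m m} S λ v → mk⇔ to (from v)
  where
  to : ∀ {v} → ∃[ s ] (s ∈ S × Edge (toℕ j) s v) → ∃[ s ] (s ∈ S × Edge m s v)
  to (s , s∈S , e) = s , s∈S , Edge-intact e

  from : ∀ v → ∃[ s ] (s ∈ S × Edge m s v) → ∃[ s ] (s ∈ S × Edge (toℕ j) s v)
  from v (s , s∈S , inj₁ s≤v)         = s , s∈S , inj₁ s≤v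
  from v (s , s∈S , inj₂ (s≡1+v , _)) with toℕ v ≟ toℕ j
  ... | no  v≢j = s , s∈S , inj₂ (s≡1+v , v≢j)
  ... | yes v≡j with any? (λ t → (t ∈? S) ×-dec (toℕ t ≤? toℕ j))
  -- The forward edge from `t` to `j` replaces the missing backward edge.
  ...   | yes (t , t∈S , t≤j) = t , t∈S , inj₁ (subst (toℕ t ≤_) (sym v≡j) t≤j)
  ...   | no  j-min           = contradiction
            (subst (_∈ S) (toℕ-injective (trans s≡1+v (cong suc v≡j))) s∈S , j-min) untested

-- In other words, `j` is the maximum of `S`, so that `j` + 1 has no forward edge into `S`.
PreTests : Subset (suc m) → Fin m → Set
PreTests S j = inject₁ j ∈ S × ¬ (∃[ t ] (t ∈ S × toℕ j < toℕ t))

PreTests-unique : ∀ {S : Subset (suc m)} {i j} → PreTests S i → PreTests S j → i ≡ j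
PreTests-unique {i = i} {j} (i∈S , i-max) (j∈S , j-max) = toℕ-injective
  (≤-antisym (≮⇒≥ λ j<i → j-max (_ , i∈S , subst (_ <_) (sym (toℕ-inject₁ i)) j<i))
             (≮⇒≥ λ i<j → i-max (_ , j∈S , subst (_ <_) (sym (toℕ-inject₁ j)) i<j)))

Pre-untested : (S : Subset (suc m)) (j : Fin m) → ¬ PreTests S j →
               Pre (ladder m (toℕ j)) S ≡ Pre (ladder m m) S
Pre-untested {m} S j untested =
  Pre-cong {G = ladder m (toℕ j)} {ladder m m} S λ v → mk⇔ to (from v)
  where
  to : ∀ {v} → ∃[ s ] (s ∈ S × Edge (toℕ j) v s) → ∃[ s ] (s ∈ S × Edge m v s)
  to (s , s∈S , e) = s , s∈S , Edge-intact e

  from : ∀ v → ∃[ s ] (s ∈ S × Edge m v s) → ∃[ s ] (s ∈ S × Edge (toℕ j) v s)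
  from v (s , s∈S , inj₁ v≤s)         = s , s∈S , inj₁ v≤s
  from v (s , s∈S , inj₂ (v≡1+s , _)) with toℕ s ≟ toℕ j
  ... | no  s≢j = s , s∈S , inj₂ (v≡1+s , s≢j)
  ... | yes s≡j with any? (λ t → (t ∈? S) ×-dec (toℕ j <? toℕ t))
  -- Here `v` is `j` + 1, and its forward edge to `t` replaces the missing one.
  ...   | yes (t , t∈S , j<t) =
            t , t∈S , inj₁ (subst (_≤ toℕ t) (sym (trans v≡1+s (cong suc s≡j))) j<t)
  ...   | no  j-max           = contradiction
            (subst (_∈ S) (toℕ-injective (trans s≡j (sym (toℕ-inject₁ j)))) s∈S , j-max) untested

-- Distances and components of ladders

module _ {m : ℕ} where

  down : ∀ d {u v : Fin (suc m)} → toℕ u ≡ d + toℕ v →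
         Σ[ w ∈ Walk (ladder m m) u v ] edges (ladder m m) w ≡ d
  down zero        u≡v with refl ← toℕ-injective u≡v = ε , refl
  down (suc d) {u} {v} u≡1+d+v =
    let w , w≡d = down d {u′} {v} (toℕ-fromℕ< d+v<)
    in inj₂ (u≡1+u′ , <⇒≢ (subst (_< m) (sym (toℕ-fromℕ< d+v<)) d+v<m)) ◅ w , cong suc w≡d
    where
    d+v<m : d + toℕ v < m
    d+v<m = s≤s⁻¹ (subst (_< suc m) u≡1+d+v (toℕ<n u))

    d+v< : d + toℕ v < suc m
    d+v< = m<n⇒m<1+n d+v<m

    u′ : Fin (suc m)
    u′ = fromℕ< d+v<

    u≡1+u′ : toℕ u ≡ suc (toℕ u′)
    u≡1+u′ = trans u≡1+d+v (cong suc (sym (toℕ-fromℕ< d+v<)))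

  short-walk : 1 ≤ m → ∀ u v → Σ[ w ∈ Walk (ladder m m) u v ] edges (ladder m m) w ≤ m
  short-walk 1≤m u v with toℕ u ≤? toℕ v
  -- If `u` and `v` coincide, this edge is a self-loop; its length 1 is where `1≤m` enters.
  ... | yes u≤v = inj₁ u≤v ◅ ε , 1≤m
  ... | no  u≰v =
    let w , w≡ = down (toℕ u ∸ toℕ v) (sym (m∸n+n≡m (≰⇒≥ u≰v)))
    in w , subst (_≤ m) (sym w≡) (≤-trans (m∸n≤m (toℕ u) (toℕ v)) (toℕ≤pred[n] u))

  -- An edge descends by at most 1. Hence no walk from `m` to 0 has fewer than `m` edges.
  descent≤edges : ∀ {u v} (w : Walk (ladder m m) u v) → toℕ u ≤ edges (ladder m m) w + toℕ v
  descent≤edges ε                      = ≤-refl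
  descent≤edges (inj₁ u≤x       ◅ w)   = m≤n⇒m≤1+n (≤-trans u≤x (descent≤edges w))
  descent≤edges (inj₂ (u≡ , _)  ◅ w)   = subst (_≤ _) (sym u≡) (s≤s (descent≤edges w))

  ladder-diameter : 1 ≤ m → IsDiameter (ladder m m) m
  ladder-diameter 1≤m =
    (fromℕ m , zero , down m (trans (toℕ-fromℕ m) (sym (+-identityʳ m))) ,
      λ w → subst₂ _≤_ (toℕ-fromℕ m) (+-identityʳ _) (descent≤edges w)) ,
    λ {u} {v} (_ , shortest) →
      let w , w≤m = short-walk 1≤m u v in ≤-trans (shortest w) w≤m

  ladder-SCC : 1 ≤ m → IsSCC (ladder m m) ⊤
  ladder-SCC 1≤m = (zero , ∈⊤) , (λ {u} {v} _ _ → proj₁ (short-walk 1≤m u v)) , λ _ _ _ → ⊆⊤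

  ladder-numberOfSCCs : 1 ≤ m → NumberOfSCCs (ladder m m) 1
  ladder-numberOfSCCs 1≤m = ⊤ ∷ [] , [] ∷ [] , (λ C → mk⇔
    (λ { (here refl) → ladder-SCC 1≤m })
    (λ (_ , _ , maximal) → here (⊆-antisym ⊆⊤
      (maximal ⊤ ⊆⊤ (proj₁ (proj₂ (ladder-SCC 1≤m))))))) , refl

  -- Only the edge from `c` + 1 to `c` could leave the part above `c`, and it is the missing one.
  above-closed : ∀ {c u v} → Walk (ladder m c) u v → c < toℕ u → c < toℕ v
  above-closed ε                     c<u = c<u
  above-closed (inj₁ u≤x ◅ w)        c<u = above-closed w (<-≤-trans c<u u≤x)
  above-closed (inj₂ (u≡ , x≢c) ◅ w) c<u =
    above-closed w (≤∧≢⇒< (s≤s⁻¹ (subst (_ <_) u≡ c<u)) (x≢c ∘ sym))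

  broken-¬SCC : (j : Fin m) → ¬ IsSCC (ladder m (toℕ j)) ⊤
  broken-¬SCC j (_ , connected , _) =
    <-irrefl (sym (toℕ-inject₁ j)) (above-closed (connected {suc j} {inject₁ j} ∈⊤ ∈⊤) ≤-refl)

-- Runs

module _ (A : Strategy (suc m)) where

  -- `D` encloses the broken ladders that the step may tell from the intact one. An operation pays
  -- for its at most one member; flips and outputs do not consult the graph. Adding `oneStepOps h`
  -- lets the bounds telescope along a run.
  step-distinguishes : ∀ b h → ∃[ D ]
    ∣ D ∣ + oneStepOps h ≤ oneStepOps (step A (ladder m m) b h) ×
    (∀ {j} → j ∉ D → step A (ladder m (toℕ j)) b h ≡ step A (ladder m m) b h)
  step-distinguishes b h with A h
  ... | pre S    =
    let D , ∣D∣≤1 , untested = subsingleton-support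
          (λ j → (inject₁ j ∈? S) ×-dec ¬? (any? λ t → (t ∈? S) ×-dec (toℕ j <? toℕ t)))
          PreTests-unique
    in D , +-monoˡ-≤ _ ∣D∣≤1 ,
       λ j∉D → cong (λ X → vertices X ∷ h) (Pre-untested S _ (untested j∉D))
  ... | post S   =
    let D , ∣D∣≤1 , untested = subsingleton-support
          (λ j → (suc j ∈? S) ×-dec ¬? (any? λ t → (t ∈? S) ×-dec (toℕ t ≤? toℕ j)))
          PostTests-unique
    in D , +-monoˡ-≤ _ ∣D∣≤1 ,
       λ j∉D → cong (λ X → vertices X ∷ h) (Post-untested S _ (untested j∉D))
  ... | flip     = ⊥ , ≤-reflexive (cong (_+ oneStepOps h) (∣⊥∣≡0 m)) , λ _ → refl
  ... | output _ = ⊥ , ≤-reflexive (cong (_+ oneStepOps h) (∣⊥∣≡0 m)) , λ _ → refl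

  runFrom-distinguishes : ∀ h (ω : Vec Bool k) → ∃[ D ]
    ∣ D ∣ + oneStepOps h ≤ oneStepOps (runFrom A (ladder m m) h ω) ×
    (∀ {j} → j ∉ D → runFrom A (ladder m (toℕ j)) h ω ≡ runFrom A (ladder m m) h ω)
  runFrom-distinguishes h []      =
    ⊥ , ≤-reflexive (cong (_+ oneStepOps h) (∣⊥∣≡0 m)) , λ _ → refl
  runFrom-distinguishes h (b ∷ ω) with step-distinguishes b h
  ... | D , ∣D∣≤ , same with runFrom-distinguishes (step A (ladder m m) b h) ω
  -- Outside `D` the first step leads to the same history as on the intact ladder, so the induction
  -- hypothesis for that history applies.
  ...   | E , ∣E∣≤ , same′ = E ∪ D , bound , λ j∉ → trans
            (cong (λ h′ → runFrom A _ h′ ω) (same (j∉ ∘ x∈p∪q⁺ ∘ inj₂)))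
            (same′ (j∉ ∘ x∈p∪q⁺ ∘ inj₁))
    where
    open ≤-Reasoning
    bound : ∣ E ∪ D ∣ + oneStepOps h ≤ oneStepOps (runFrom A (ladder m m) h (b ∷ ω))
    bound = begin
      ∣ E ∪ D ∣ + oneStepOps h                         ≤⟨ +-monoˡ-≤ _ (∣p∪q∣≤∣p∣+∣q∣ E D) ⟩
      ∣ E ∣ + ∣ D ∣ + oneStepOps h                     ≡⟨ +-assoc ∣ E ∣ ∣ D ∣ _ ⟩
      ∣ E ∣ + (∣ D ∣ + oneStepOps h)                   ≤⟨ +-monoʳ-≤ ∣ E ∣ ∣D∣≤ ⟩
      ∣ E ∣ + oneStepOps (step A (ladder m m) b h)     ≤⟨ ∣E∣≤ ⟩
      oneStepOps (runFrom A (ladder m m) h (b ∷ ω))    ∎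

  -- Equal histories give equal outputs, but `⊤` must be listed for the intact ladder and must not
  -- be for a broken one.
  not-both-correct : 1 ≤ m → ∀ j {ω : Vec Bool k} →
                     run A (ladder m (toℕ j)) ω ≡ run A (ladder m m) ω →
                     OutputsSCCs A (ladder m m) ω → ¬ OutputsSCCs A (ladder m (toℕ j)) ω
  not-both-correct 1≤m j same (Cs , out , correct) (Cs′ , out′ , correct′)
    with refl ← trans (sym out) (trans (cong A (sym same)) out′) =
    broken-¬SCC j (Equivalence.to (correct′ ⊤) (Equivalence.from (correct ⊤) (ladder-SCC 1≤m)))

-- Success under additional coin flips

module _ (A : Strategy n) (G : Graph n) where

  runFrom-output : ∀ {h Cs} → A h ≡ output Cs → (ω : Vec Bool k) → runFrom A G h ω ≡ h
  runFrom-output         out []      = refl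
  runFrom-output {h = h} out (b ∷ ω) =
    trans (cong (λ h′ → runFrom A G h′ ω) (step-output out)) (runFrom-output out ω)
    where
    step-output : ∀ {Cs} → A h ≡ output Cs → step A G b h ≡ h
    step-output out rewrite out = refl

  runFrom-take : ∀ k {d h Cs} (ω : Vec Bool (k + d)) →
                 A (runFrom A G h (take k ω)) ≡ output Cs →
                 runFrom A G h ω ≡ runFrom A G h (take k ω)
  runFrom-take zero    ω       out = runFrom-output out ω
  runFrom-take (suc k) (b ∷ ω) out = runFrom-take k ω out

  OutputsSCCs-take : ∀ k {d} (ω : Vec Bool (k + d)) →
                     OutputsSCCs A G (take k ω) → OutputsSCCs A G ω
  OutputsSCCs-take k ω (Cs , out , correct) =
    Cs , trans (cong A (runFrom-take k ω out)) out , correct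

  -- 7/12 = 2/3 - 1/12, where any ε < 1/6 would do in place of 1/12.
  Success : ℕ → Set
  Success k = Σ[ b ∈ (Vec Bool k → Bool) ]
    (∀ {ω} → b ω ≡ true → OutputsSCCs A G ω) × 2 ^ k * 7 ≤ 12 * ∑ (χ ∘ b)

  -- An output is never retracted, so every continuation of a successful prefix succeeds and the
  -- success rate is preserved.
  Success-+ : ∀ d → Success k → Success (k + d)
  Success-+ {k} d (b , correct , often) =
    b ∘ take k , (λ {ω} bω → OutputsSCCs-take k ω (correct bω)) , (begin
      2 ^ (k + d) * 7              ≡⟨ cong (_* 7) (^-distribˡ-+-* 2 k d) ⟩
      2 ^ k * 2 ^ d * 7            ≡⟨ shuffle₁ (2 ^ k) (2 ^ d) ⟩
      2 ^ d * (2 ^ k * 7)          ≤⟨ *-monoʳ-≤ (2 ^ d) often ⟩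
      2 ^ d * (12 * ∑ (χ ∘ b))     ≡⟨ shuffle₂ (2 ^ d) (∑ (χ ∘ b)) ⟩
      12 * (2 ^ d * ∑ (χ ∘ b))     ≡⟨ cong (12 *_) (∑-take k d (χ ∘ b)) ⟨
      12 * ∑ (χ ∘ b ∘ take k)      ∎)
    where
    open ≤-Reasoning
    shuffle₁ : ∀ s t → s * t * 7 ≡ t * (s * 7)
    shuffle₁ = solve-∀
    shuffle₂ : ∀ s t → s * (12 * t) ≡ 12 * (s * t)
    shuffle₂ = solve-∀

-- From probabilities to counts

/-cancel-≤ : ∀ {a b c d} .{{_ : NonZero b}} .{{_ : NonZero d}} →
             + a ℚ./ b ℚ.≤ + c ℚ./ d → a * d ≤ c * b
/-cancel-≤ {a} {suc b} {c} {suc d} a/b≤c/d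
  with *≤* ad≤cb ← ℚᵘ.≤-respʳ-≃ (ℚ.toℚᵘ-fromℚᵘ (mkℚᵘ (+ c) d))
                    (ℚᵘ.≤-respˡ-≃ (ℚ.toℚᵘ-fromℚᵘ (mkℚᵘ (+ a) b)) (ℚ.toℚᵘ-mono-≤ a/b≤c/d)) =
  drop‿+≤+ (subst₂ ℤ._≤_ (sym (pos-* a (suc d))) (sym (pos-* c (suc b))) ad≤cb)

module _ {k : ℕ} where

  private
    _≟ω_ = ≡-dec {n = k} _≟ᵇ_
  open DecMembership _≟ω_ using () renaming (_∈?_ to _∈ˡ?_)

  -- Prepending an outcome absent from the list raises the indicator there from 0 to 1 and lowers it
  -- nowhere.
  length≤∑ : ∀ {ωs} → Unique ωs → length ωs ≤ ∑ (λ ω → χ (does (ω ∈ˡ? ωs)))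
  length≤∑ []                     = z≤n
  length≤∑ {ω ∷ ωs} (ω∉ωs ∷ uniq) = ≤-<-trans (length≤∑ uniq) (∑-mono-< grows ω new)
    where
    χ≤χ∨ : ∀ b c → χ c ≤ χ (b ∨ c)
    χ≤χ∨ false c     = ≤-refl
    χ≤χ∨ true  false = z≤n
    χ≤χ∨ true  true  = ≤-refl

    grows : ∀ ω′ → χ (does (ω′ ∈ˡ? ωs)) ≤ χ (does (ω′ ∈ˡ? (ω ∷ ωs)))
    grows ω′ = χ≤χ∨ (does (ω′ ≟ω ω)) _

    new : χ (does (ω ∈ˡ? ωs)) < χ (does (ω ∈ˡ? (ω ∷ ωs)))
    new rewrite dec-true (ω ≟ω ω) refl
              | dec-false (ω ∈ˡ? ωs) (All¬⇒¬Any ω∉ωs) = ≤-refl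

  -- Correctness comes without a decision procedure, but membership in the list of witnesses is
  -- decidable and supplies the Boolean test.
  ProbabilityAtLeast⇒Success : {A : Strategy n} {G : Graph n} →
    ProbabilityAtLeast (+ 7 ℚ./ 12) (OutputsSCCs A G {k}) → Success A G k
  ProbabilityAtLeast⇒Success {A = A} {G} (ωs , uniq , correct , often) =
    (λ ω → does (ω ∈ˡ? ωs)) , outputs , (begin
      2 ^ k * 7                                  ≡⟨ *-comm (2 ^ k) 7 ⟩
      7 * 2 ^ k                                  ≤⟨ /-cancel-≤ {7} {12} {length ωs} {2 ^ k} {{_}} {{m^n≢0 2 k}} often ⟩
      length ωs * 12                             ≡⟨ *-comm (length ωs) 12 ⟩
      12 * length ωs                             ≤⟨ *-monoʳ-≤ 12 (length≤∑ uniq) ⟩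
      12 * ∑ (λ ω → χ (does (ω ∈ˡ? ωs)))         ∎)
    where
    open ≤-Reasoning
    outputs : ∀ {ω} → does (ω ∈ˡ? ωs) ≡ true → OutputsSCCs A G ω
    outputs {ω} eq with yes ω∈ωs ← ω ∈ˡ? ωs = All.lookup correct ω∈ωs

1/12-positive : 0ℚ ℚ.< + 1 ℚ./ 12
1/12-positive = ℚ.*<* (+<+ z<s)

SolvesSCC⇒Success : ∀ A → SolvesSCC A → (G : Graph n) → ∃[ k ] Success (A n) G k
SolvesSCC⇒Success A (inj₁ (_ , solves)) G =
  let k , correct = solves G
  in k , (λ _ → true) , (λ {ω} _ → correct ω) , (begin
    2 ^ k * 7               ≤⟨ *-monoʳ-≤ (2 ^ k) (m≤m+n 7 5) ⟩
    2 ^ k * 12              ≡⟨ *-comm (2 ^ k) 12 ⟩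
    12 * 2 ^ k              ≡⟨ cong (12 *_) (*-identityʳ (2 ^ k)) ⟨
    12 * (2 ^ k * 1)        ≡⟨ cong (12 *_) (∑-const k 1) ⟨
    12 * ∑ {k} (λ _ → 1)    ∎)
  where open ≤-Reasoning
SolvesSCC⇒Success A (inj₂ solves) G =
  let k , likely = solves G (+ 1 ℚ./ 12) 1/12-positive
  -- The probability 2/3 - 1/12 in the type of `likely` evaluates to 7/12.
  in k , ProbabilityAtLeast⇒Success {A = A _} {G} likely

-- Averaging over the coin flips

-- The number of steps may depend on the graph, whereas averaging compares all ladders on the same
-- flips. By `pad`, the sum of the individual bounds serves for all of them.
uniform-bound : {P : ℕ → ℕ → Set} → (∀ {c k} d → P c k → P c (k + d)) →
                (∀ c → ∃[ k ] P c k) → ∀ m → ∃[ k ] (∀ c → c < m → P c k)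
uniform-bound pad ex zero    = 0 , λ _ ()
uniform-bound {P} pad ex (suc m) with uniform-bound {P} pad ex m | ex m
... | k , upto | k′ , last = k + k′ , bound
  where
  bound : ∀ c → c < suc m → P c (k + k′)
  bound c c<1+m with c ≟ m
  ... | yes refl = subst (P m) (+-comm k′ k) (pad k last)
  ... | no  c≢m  = pad k′ (upto c (≤∧≢⇒< (s≤s⁻¹ c<1+m) c≢m))

many-operations : 1 ≤ m → (A : Strategy (suc m)) → (∀ c → ∃[ k ] Success A (ladder m c) k) →
                  ∃[ k ] Σ[ ω ∈ Vec Bool k ] m ≤ 6 * oneStepOps (run A (ladder m m) ω)
many-operations {m} 1≤m A succeeds
  -- The bound `suc m` covers the broken ladders `c < m` together with the intact one, `c` = `m`.
  with K , all ← uniform-bound {P = λ c → Success A (ladder m c)}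
                   (λ d → Success-+ A _ d) succeeds (suc m)
  = K , ∑-average m (λ ω → 6 * ops ω)
          (subst (2 ^ K * m ≤_) (sym (*-distribˡ-∑ 6 ops)) total)
  where
  ops : Vec Bool K → ℕ
  ops ω = oneStepOps (run A (ladder m m) ω)

  intact : Success A (ladder m m) K
  intact = all m ≤-refl

  broken : (j : Fin m) → Success A (ladder m (toℕ j)) K
  broken j = all (toℕ j) (m<n⇒m<1+n (toℕ<n j))

  a : Vec Bool K → Bool
  a = proj₁ intact

  B : Vec Bool K → Subset m
  B ω = tabulate λ j → proj₁ (broken j) ω

  pointwise : ∀ ω → ∣ B ω ∣ + m * χ (a ω) ≤ m + ops ω
  pointwise ω with a ω in eq
  -- Without certified success on the intact ladder, it suffices that there are only `m` broken
  -- ones.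
  ... | false = +-mono-≤ (∣p∣≤n (B ω)) (≤-trans (≤-reflexive (*-zeroʳ m)) z≤n)
  ... | true
    with D , ∣D∣≤ , same ← runFrom-distinguishes A [] ω = begin
    ∣ B ω ∣ + m * 1     ≡⟨ cong (λ x → ∣ B ω ∣ + x) (*-identityʳ m) ⟩
    ∣ B ω ∣ + m         ≤⟨ +-monoˡ-≤ m (p⊆q⇒∣p∣≤∣q∣ B⊆D) ⟩
    ∣ D ∣ + m           ≡⟨ cong (_+ m) (+-identityʳ ∣ D ∣) ⟨
    ∣ D ∣ + 0 + m       ≤⟨ +-monoˡ-≤ m ∣D∣≤ ⟩
    ops ω + m           ≡⟨ +-comm (ops ω) m ⟩
    m + ops ω           ∎
    where
    open ≤-Reasoning
    B⊆D : ∀ {j} → j ∈ B ω → j ∈ D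
    B⊆D {j} j∈B with j ∈? D
    ... | yes j∈D = j∈D
    ... | no  j∉D = contradiction
      (proj₁ (proj₂ (broken j)) (trans (sym (lookup∘tabulate _ j)) ([]=⇒lookup j∈B)))
      (not-both-correct A 1≤m j {ω} (same j∉D) (proj₁ (proj₂ intact) eq))

  summed : ∑ (λ ω → ∣ B ω ∣) + m * ∑ (χ ∘ a) ≤ 2 ^ K * m + ∑ ops
  summed = begin
    ∑ (λ ω → ∣ B ω ∣) + m * ∑ (χ ∘ a)               ≡⟨ cong (λ x → ∑ (λ ω → ∣ B ω ∣) + x) (*-distribˡ-∑ m (χ ∘ a)) ⟨
    ∑ (λ ω → ∣ B ω ∣) + ∑ (λ ω → m * χ (a ω))       ≡⟨ ∑-distrib-+ (λ ω → ∣ B ω ∣) (λ ω → m * χ (a ω)) ⟨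
    ∑ (λ ω → ∣ B ω ∣ + m * χ (a ω))                 ≤⟨ ∑-mono-≤ pointwise ⟩
    ∑ (λ ω → m + ops ω)                             ≡⟨ ∑-distrib-+ (λ _ → m) ops ⟩
    ∑ {K} (λ _ → m) + ∑ ops                         ≡⟨ cong (_+ ∑ ops) (∑-const K m) ⟩
    2 ^ K * m + ∑ ops                               ∎
    where open ≤-Reasoning

  total : 2 ^ K * m ≤ 6 * ∑ ops
  -- With M for `2 ^ K * m`, the `m` broken ladders and the intact one with weight `m` give 14 M ≤
  -- 12 (M + `∑ ops`). Cancelling 12 M and then the factor 2 leaves the claim.
  total = *-cancelˡ-≤ 2 (+-cancelˡ-≤ (12 * (2 ^ K * m)) _ _ (begin
    12 * (2 ^ K * m) + 2 * (2 ^ K * m)               ≡⟨ split (2 ^ K) m ⟩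
    m * (2 ^ K * 7) + m * (2 ^ K * 7)                ≤⟨ +-mono-≤
      (∑-∣tabulate∣-≥ 12 (2 ^ K * 7) (proj₁ ∘ broken) (proj₂ ∘ proj₂ ∘ broken))
      (*-monoʳ-≤ m (proj₂ (proj₂ intact))) ⟩
    12 * ∑ (λ ω → ∣ B ω ∣) + m * (12 * ∑ (χ ∘ a))    ≡⟨ factor (∑ (λ ω → ∣ B ω ∣)) m (∑ (χ ∘ a)) ⟩
    12 * (∑ (λ ω → ∣ B ω ∣) + m * ∑ (χ ∘ a))         ≤⟨ *-monoʳ-≤ 12 summed ⟩
    12 * (2 ^ K * m + ∑ ops)                         ≡⟨ expand (2 ^ K * m) (∑ ops) ⟩
    12 * (2 ^ K * m) + 2 * (6 * ∑ ops)               ∎))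
    where
    open ≤-Reasoning
    split : ∀ t m → 12 * (t * m) + 2 * (t * m) ≡ m * (t * 7) + m * (t * 7)
    split = solve-∀
    factor : ∀ x m y → 12 * x + m * (12 * y) ≡ 12 * (x + m * y)
    factor = solve-∀
    expand : ∀ x y → 12 * (x + y) ≡ 12 * x + 2 * (6 * y)
    expand = solve-∀

-- The lower bounds

1/12*-mono : ∀ {g q} → g ≤ 12 * q → + 1 ℚ./ 12 ℚ.* (+ g ℚ./ 1) ℚ.≤ + q ℚ./ 1
1/12*-mono {g} {q} g≤12q = ℚ.toℚᵘ-cancel-≤
  (ℚᵘ.≤-respˡ-≃ (ℚᵘ.≃-sym lhs)
    (ℚᵘ.≤-respʳ-≃ (ℚᵘ.≃-sym (ℚ.toℚᵘ-fromℚᵘ (mkℚᵘ (+ q) 0))) (*≤* scaled)))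
  where
  lhs : ℚ.toℚᵘ (+ 1 ℚ./ 12 ℚ.* (+ g ℚ./ 1)) ℚᵘ.≃ mkℚᵘ (+ 1) 11 ℚᵘ.* mkℚᵘ (+ g) 0
  lhs = ℚᵘ.≃-trans (ℚ.toℚᵘ-homo-* (+ 1 ℚ./ 12) (+ g ℚ./ 1))
    (ℚᵘ.*-congˡ {mkℚᵘ (+ 1) 11} (ℚ.toℚᵘ-fromℚᵘ (mkℚᵘ (+ g) 0)))

  scaled : + 1 ℤ.* + g ℤ.* + 1 ℤ.≤ + q ℤ.* + 12
  scaled = subst₂ ℤ._≤_
    (trans (pos-* (1 * g) 1) (cong (ℤ._* + 1) (pos-* 1 g))) (pos-* q 12)
    (+≤+ (subst₂ _≤_ (sym (trans (*-identityʳ (1 * g)) (*-identityˡ g))) (*-comm 12 q) g≤12q))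

-- The constant 1/12 is the 1/6 of `many-operations` halved by `g ≤ 2 * m`; this slack accommodates
-- the `m` + 1 vertices of the ladder.
ladder-bound : {P : Parameter} →
               (∀ m → 1 ≤ m → ∃[ g ] P (ladder m m) g × m ≤ g × g ≤ 2 * m) → SCCNeedsΩ P
ladder-bound {P} value = + 1 ℚ./ 12 , 1/12-positive , lower
  where
  lower : ∀ A → SolvesSCC A → ∀ N → ∃[ n ] Σ[ G ∈ Graph n ] ∃[ g ]
          P G g × N ≤ g × Performs≥ (A n) G (+ 1 ℚ./ 12 ℚ.* (+ g ℚ./ 1))
  lower A solves N =
    let g , Pg , m≤g , g≤2m = value (suc N) (s≤s z≤n)
        k , ω , m≤6q = many-operations (s≤s z≤n) (A _)
          (λ c → SolvesSCC⇒Success A solves (ladder (suc N) c))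
        q = oneStepOps (run (A (2 + N)) (ladder (suc N) (suc N)) ω)
    in _ , ladder (suc N) (suc N) , g , Pg , ≤-trans (n≤1+n N) m≤g , k , ω , 1/12*-mono {q = q}
         (≤-trans g≤2m (≤-trans (*-monoʳ-≤ 2 m≤6q) (≤-reflexive (sym (*-assoc 2 6 q)))))

theorem3p2 : SCCNeedsΩ numberOfVertices × SCCNeedsΩ numberOfSCCs×diameter
theorem3p2 =
  ladder-bound (λ m 1≤m → suc m , refl , n≤1+n m , +-mono-≤ 1≤m (m≤m+n m 0)) ,
  ladder-bound (λ m 1≤m → m , (1 , m , ladder-numberOfSCCs 1≤m , ladder-diameter 1≤m ,
                               sym (*-identityˡ m)) , ≤-refl , m≤m+n m _)
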